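{- For every monotone subset $Q\subseteq\mathsf{List}(\mathbb{N})$: if $\mathrm{TBar}([\,],Q)$ holds (i.e. $Q$ is a bar over the empty list realized by a closed System T term of type $(\mathsf{nat}\to\mathsf{nat})\to\mathsf{nat}$), then $\mathrm{IndBar}([\,],Q)$ holds.
   Context: Setting: constructive metatheory (e.g. Martin-Löf type theory with function extensionality; no excluded middle, no axiom of choice). Lists and sequences. $\mathsf{List}(\mathbb{N})$ is the set of finite lists of naturals, $[\,]$ the empty list, $\vec u\cdot\vec v$ concatenation, $\vec u\cdot x$ the list $\vec u$ with the element $x$ appended at the end. $\vec u\preceq\vec v$ means $\vec u$ is a prefix of $\vec v$. For $\alpha:\mathbb{N}\to\mathbb{N}$, $\alpha[k]$ is the list of the first $k$ values of $\alpha$. A subset $Q\subseteq\mathsf{List}(\mathbb{N})$ (not assumed decidable) is monotone if $\vec v\in Q$ and $\vec v\preceq\vec w$ imply $\vec w\in Q$. Inductive barhood. $\mathrm{IndBar}(\vec u,Q)$ is the inductively generated predicate with two rules: (η) if $\vec u\in Q$ then $\mathrm{IndBar}(\vec u,Q)$; (ϝ) if $\mathrm{IndBar}(\vec u\cdot x,Q)$ for all $x:\mathbb{N}$, then $\mathrm{IndBar}(\vec u,Q)$. System T. Types: $\sigma,\tau ::= \mathsf{nat}\mid\sigma\to\tau$. A context $\Gamma$ assigns types to finitely many distinct variables. Terms, up to $\alpha$-equivalence: variables $x$; $\lambda x.M$; application $M(N)$ (annotated with the domain type); $\mathsf{z}$; $\mathsf{s}(M)$; $\mathsf{rec}(N;M_z;x.h.M_s)$.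 Typing $\Gamma\vdash M:\sigma$ is the usual simply typed one, with $\Gamma\vdash\mathsf{z}:\mathsf{nat}$; $\Gamma\vdash\mathsf{s}(M):\mathsf{nat}$ if $\Gamma\vdash M:\mathsf{nat}$; and $\Gamma\vdash\mathsf{rec}(N;M_z;x.h.M_s):\sigma$ if $\Gamma\vdash N:\mathsf{nat}$, $\Gamma\vdash M_z:\sigma$ and $\Gamma,x:\mathsf{nat},h:\sigma\vdash M_s:\sigma$. Standard semantics. $[\![\mathsf{nat}]\!]=\mathbb{N}$, $[\![\sigma\to\tau]\!]=[\![\sigma]\!]\to[\![\tau]\!]$ (all functions), $[\![\Gamma]\!]=\prod_{x\in\mathrm{dom}\,\Gamma}[\![\Gamma(x)]\!]$. A term $\Gamma\vdash M:\sigma$ is interpreted as the evident function $[\![M]\!]:[\![\Gamma]\!]\to[\![\sigma]\!]$ (variables by lookup, abstraction and application by functions, $\mathsf{z}$ as $0$, $\mathsf{s}$ as successor, $\mathsf{rec}$ by primitive recursion: $r(0)=[\![M_z]\!]g$ and $r(n+1)=[\![M_s]\!](g,x\mapsto n,h\mapsto r(n))$, evaluated at $[\![N]\!]g$). T-realizable barhood. $\mathrm{TBar}(\vec u,Q)$ means: there is a closed term $\cdot\vdash F:(\mathsf{nat}\to\mathsf{nat})\to\mathsf{nat}$ such that for all $\alpha:\mathbb{N}\to\mathbb{N}$, $\vec u\cdot\alpha\big[[\![F]\!](\alpha)\big]\in Q$. -}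

module Defs where

open import Data.List.Base using (List; []; _∷_; _++_; _∷ʳ_; applyUpTo)
open import Data.List.Membership.Propositional using () renaming (_∈_ to _∈ˡ_)
open import Data.List.Relation.Binary.Prefix.Heterogeneous using (Prefix)
open import Data.List.Relation.Unary.All using (All; []; _∷_; lookup)
open import Data.Nat.Base using (ℕ; zero; suc)
open import Data.Product.Base using (Σ-syntax)
open import Level using (Level)
open import Relation.Binary.PropositionalEquality using (_≡_)
open import Relation.Unary using (Pred; _∈_)

private variable
  ℓ : Level

infix 4 _≼_

_≼_ : List ℕ → List ℕ → Set
_≼_ = Prefix _≡_

Monotone : Pred (List ℕ) ℓ → Set ℓ
Monotone Q = ∀ {v w} → v ∈ Q → v ≼ w → w ∈ Q

data IndBar {ℓ} (u : List ℕ) (Q : Pred (List ℕ) ℓ) : Set ℓ where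
  η : u ∈ Q → IndBar u Q
  ϝ : (∀ x → IndBar (u ∷ʳ x) Q) → IndBar u Q

infixr 7 _⇒_

data Ty : Set where
  nat : Ty
  _⇒_ : Ty → Ty → Ty

-- Variables are de Bruijn indices, most recently bound first.
Ctx : Set
Ctx = List Ty

private variable
  σ τ : Ty
  Γ   : Ctx

infix 3 _⊢_

-- Intrinsically typed terms.  De Bruijn indices account for α-equivalence;
-- the domain-type annotation on an application is the implicit σ of app.
data _⊢_ (Γ : Ctx) : Ty → Set where
  var : σ ∈ˡ Γ → Γ ⊢ σ
  lam : σ ∷ Γ ⊢ τ → Γ ⊢ σ ⇒ τ
  app : Γ ⊢ σ ⇒ τ → Γ ⊢ σ → Γ ⊢ τ
  ze  : Γ ⊢ nat
  su  : Γ ⊢ nat → Γ ⊢ nat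
  -- rec N Mz Ms: in Ms, index 0 is the recursive value h and index 1 is the
  -- predecessor x.
  rec : Γ ⊢ nat → Γ ⊢ σ → σ ∷ nat ∷ Γ ⊢ σ → Γ ⊢ σ

⟦_⟧ᵗ : Ty → Set
⟦ nat ⟧ᵗ   = ℕ
⟦ σ ⇒ τ ⟧ᵗ = ⟦ σ ⟧ᵗ → ⟦ τ ⟧ᵗ

⟦_⟧ᶜ : Ctx → Set
⟦ Γ ⟧ᶜ = All ⟦_⟧ᵗ Γ

primrec : {A : Set} → A → (ℕ → A → A) → ℕ → A
primrec a f zero    = a
primrec a f (suc n) = f n (primrec a f n)

⟦_⟧ : Γ ⊢ σ → ⟦ Γ ⟧ᶜ → ⟦ σ ⟧ᵗ
⟦ var i ⟧       g = lookup g i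
⟦ lam M ⟧       g = λ a → ⟦ M ⟧ (a ∷ g)
⟦ app M N ⟧     g = ⟦ M ⟧ g (⟦ N ⟧ g)
⟦ ze ⟧          g = zero
⟦ su M ⟧        g = suc (⟦ M ⟧ g)
⟦ rec N Mz Ms ⟧ g = primrec (⟦ Mz ⟧ g) (λ n r → ⟦ Ms ⟧ (r ∷ n ∷ g)) (⟦ N ⟧ g)

TBar : List ℕ → Pred (List ℕ) ℓ → Set ℓ
TBar u Q =
  Σ[ F ∈ [] ⊢ (nat ⇒ nat) ⇒ nat ]
    (∀ (α : ℕ → ℕ) → u ++ applyUpTo α (⟦ F ⟧ [] α) ∈ Q)

{-# OPTIONS --safe #-}
-- In the model of System T where naturals are dialogue trees querying an
-- unknown sequence, applying F to the generic sequence yields a tree that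
-- computes ⟦ F ⟧ α for every α (Escardó).  Structural induction on this tree
-- replaces bar induction: before descending through a query at position i,
-- use ϝ to lengthen the current list beyond i, so that it fixes the answer.
module Submission where

open import Defs
open import Data.List.Base using (List; []; _∷_; _++_; _∷ʳ_; applyUpTo; length)
open import Data.List.Membership.Propositional using () renaming (_∈_ to _∈ˡ_)
open import Data.List.Properties using (++-assoc; ++-identityʳ; length-++)
open import Data.List.Relation.Binary.Prefix.Heterogeneous using ([]; _∷_)
open import Data.List.Relation.Unary.All using (All; []; _∷_; lookup)
open import Data.List.Relation.Unary.Any using (here; there)
open import Data.Nat.Base using (ℕ; zero; suc; _≤_; _<_; s≤s)
open import Data.Nat.Properties using (m≤n+m; ≤-reflexive; ≤-trans)
open import Data.Product.Base using (_,_)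
open import Function.Base using (_∘_)
open import Level using (Level)
open import Relation.Binary.PropositionalEquality
  using (_≡_; refl; sym; cong; subst)
open import Relation.Unary using (Pred; _∈_)

private variable
  ℓ   : Level
  σ τ : Ty
  Γ   : Ctx

data Dialogue : Set where
  answer : ℕ → Dialogue
  query  : ℕ → (ℕ → Dialogue) → Dialogue

run : (ℕ → ℕ) → Dialogue → ℕ
run α (answer n)  = n
run α (query i φ) = run α (φ (α i))

⟦_⟧ᴰ : Ty → Set
⟦ nat ⟧ᴰ   = Dialogue
⟦ σ ⇒ τ ⟧ᴰ = ⟦ σ ⟧ᴰ → ⟦ τ ⟧ᴰ

-- Kleisli extension for the dialogue monad, made pointwise at arrow types so that `rec` can
-- eliminate a tree-valued number into any type.
extend : ∀ σ → (ℕ → ⟦ σ ⟧ᴰ) → Dialogue → ⟦ σ ⟧ᴰ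
extend nat     f (answer n)  = f n
extend nat     f (query i φ) = query i (λ k → extend nat f (φ k))
extend (σ ⇒ τ) f d           = λ a → extend τ (λ n → f n a) d

evalᴰ : Γ ⊢ σ → All ⟦_⟧ᴰ Γ → ⟦ σ ⟧ᴰ
evalᴰ (var i)   g = lookup g i
evalᴰ (lam M)   g = λ a → evalᴰ M (a ∷ g)
evalᴰ (app M N) g = evalᴰ M g (evalᴰ N g)
evalᴰ ze        g = answer zero
evalᴰ (su M)    g = extend nat (answer ∘ suc) (evalᴰ M g)
evalᴰ (rec {σ = σ} N Mz Ms) g =
  extend σ (primrec (evalᴰ Mz g) (λ n r → evalᴰ Ms (r ∷ answer n ∷ g))) (evalᴰ N g)

generic : ⟦ nat ⇒ nat ⟧ᴰ
generic = extend nat (λ i → query i answer)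

module _ (α : ℕ → ℕ) where

  -- A logical relation between the two models for a fixed `α`; at base type, running the tree
  -- against `α` returns the number.
  Related : ∀ σ → ⟦ σ ⟧ᵗ → ⟦ σ ⟧ᴰ → Set
  Related nat     n d = n ≡ run α d
  Related (σ ⇒ τ) f h = ∀ {a b} → Related σ a b → Related τ (f a) (h b)

  Relatedᶜ : ⟦ Γ ⟧ᶜ → All ⟦_⟧ᴰ Γ → Set
  Relatedᶜ {Γ} g h = ∀ {σ} (i : σ ∈ˡ Γ) → Related σ (lookup g i) (lookup h i)

  related-∷ : ∀ {g : ⟦ Γ ⟧ᶜ} {h a b} →
              Related σ a b → Relatedᶜ g h → Relatedᶜ (a ∷ g) (b ∷ h)
  related-∷ r rs (here refl) = r
  related-∷ r rs (there i)   = rs i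

  related-extend : ∀ σ {f h} → (∀ n → Related σ (f n) (h n)) →
                   Related (nat ⇒ σ) f (extend σ h)
  related-extend nat     r {b = answer n}  refl = r n
  -- Running a query against `α` just moves to the branch `φ (α i)`, so recursion on that branch
  -- suffices.
  related-extend nat     r {b = query i φ} refl = related-extend nat r {b = φ (α i)} refl
  related-extend (σ ⇒ τ) r {b = d} eq s = related-extend τ (λ n → r n s) {b = d} eq

  related-primrec : ∀ {a b f h} → Related σ a b →
                    (∀ n {x y} → Related σ x y → Related σ (f n x) (h n y)) →
                    ∀ n → Related σ (primrec a f n) (primrec b h n)
  related-primrec r s zero    = r
  related-primrec r s (suc n) = s n (related-primrec r s n)

  related-eval : (M : Γ ⊢ σ) → ∀ {g h} → Relatedᶜ g h → Related σ (⟦ M ⟧ g) (evalᴰ M h)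
  related-eval (var i)   rs = rs i
  related-eval (lam M)   rs = λ r → related-eval M (related-∷ r rs)
  related-eval (app M N) rs = related-eval M rs (related-eval N rs)
  related-eval ze        rs = refl
  related-eval (su M) {h = h} rs =
    related-extend nat (λ _ → refl) {b = evalᴰ M h} (related-eval M rs)
  related-eval (rec {σ = σ} N Mz Ms) {h = h} rs =
    related-extend σ
      (related-primrec (related-eval Mz rs)
        (λ n r → related-eval Ms (related-∷ r (related-∷ refl rs))))
      {b = evalᴰ N h} (related-eval N rs)

  related-generic : Related (nat ⇒ nat) α generic
  related-generic {b = d} eq = related-extend nat (λ _ → refl) {b = d} eq

dialogue : [] ⊢ (nat ⇒ nat) ⇒ nat → Dialogue
dialogue F = evalᴰ F [] generic

dialogue-correct : ∀ F α → ⟦ F ⟧ [] α ≡ run α (dialogue F)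
dialogue-correct F α =
  related-eval α F (λ ()) (λ {_} {d} → related-generic α {b = d})

infix 4 _◁_

data _◁_ : List ℕ → (ℕ → ℕ) → Set where
  []  : ∀ {α} → [] ◁ α
  _∷_ : ∀ {x u α} → α 0 ≡ x → u ◁ α ∘ suc → x ∷ u ◁ α

-- A canonical sequence through a given list. It also serves as a total lookup: its default 0 is
-- never read at positions inside the list.
pad : List ℕ → ℕ → ℕ
pad []      _       = 0
pad (x ∷ u) zero    = x
pad (x ∷ u) (suc i) = pad u i

◁-pad : ∀ u → u ◁ pad u
◁-pad []      = []
◁-pad (x ∷ u) = refl ∷ ◁-pad u

◁-++⁻ˡ : ∀ u {v α} → u ++ v ◁ α → u ◁ α
◁-++⁻ˡ []      p        = []
◁-++⁻ˡ (x ∷ u) (eq ∷ p) = eq ∷ ◁-++⁻ˡ u p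

◁-pad-≡ : ∀ {u α i} → i < length u → u ◁ α → α i ≡ pad u i
◁-pad-≡ {x ∷ u} {i = zero}  _         (eq ∷ p) = eq
◁-pad-≡ {x ∷ u} {i = suc i} (s≤s i<u) (eq ∷ p) = ◁-pad-≡ i<u p

◁-applyUpTo-≼ : ∀ {u α n} → n ≤ length u → u ◁ α → applyUpTo α n ≼ u
◁-applyUpTo-≼ {n = zero}              _         _        = []
◁-applyUpTo-≼ {u = x ∷ u} {n = suc n} (s≤s n≤u) (eq ∷ p) = eq ∷ ◁-applyUpTo-≼ n≤u p

module _ {Q : Pred (List ℕ) ℓ} where

  -- Appending `k` entries makes the list at least `k` long whatever its length was, so no case
  -- distinction on that length is required.
  ϝ* : ∀ k {u} → (∀ v → length v ≡ k → IndBar (u ++ v) Q) → IndBar u Q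
  ϝ* zero    {u} b = subst (λ w → IndBar w Q) (++-identityʳ u) (b [] refl)
  ϝ* (suc k) {u} b = ϝ λ x → ϝ* k λ v eq →
    subst (λ w → IndBar w Q) (sym (++-assoc u (x ∷ []) v)) (b (x ∷ v) (cong suc eq))

  ≤-length-++ : ∀ u {v : List ℕ} {k} → length v ≡ k → k ≤ length (u ++ v)
  ≤-length-++ u {v} refl =
    ≤-trans (m≤n+m (length v) (length u)) (≤-reflexive (sym (length-++ u)))

  -- Only sequences through `u` are constrained: this lets the induction pass to the one branch that
  -- a longer list selects.
  dialogue⇒IndBar : Monotone Q → ∀ d {u} →
                    (∀ α → u ◁ α → applyUpTo α (run α d) ∈ Q) → IndBar u Q
  dialogue⇒IndBar mono (answer n) {u} bar = ϝ* n λ v eq →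
    -- The stopping time is now the constant `n`, so one sequence through `u ++ v` is enough: its
    -- first `n` values form a prefix of that list, and monotonicity applies.
    let p = ◁-pad (u ++ v)
    in η (mono (bar _ (◁-++⁻ˡ u p)) (◁-applyUpTo-≼ (≤-length-++ u eq) p))
  dialogue⇒IndBar mono (query i φ) {u} bar = ϝ* (suc i) λ v eq →
    dialogue⇒IndBar mono (φ (pad (u ++ v) i)) λ α p →
      -- With `suc i` entries appended, position `i` lies inside `u ++ v`, so every `α` through this
      -- list takes the same branch at the query.
      subst (λ k → applyUpTo α (run α (φ k)) ∈ Q)
            (◁-pad-≡ (≤-length-++ u eq) p) (bar α (◁-++⁻ˡ u p))

theorem4p1 : {ℓ : Level} (Q : Pred (List ℕ) ℓ) → Monotone Q → TBar [] Q → IndBar [] Q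
theorem4p1 Q mono (F , bar) = dialogue⇒IndBar mono (dialogue F) λ α _ →
  subst (λ n → applyUpTo α n ∈ Q) (dialogue-correct F α) (bar α)
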